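{- For the Steiner tree problem with revenues, budgets and hop constraints (STPRBH), the partial-ordering model (P-STPRBH) is strictly stronger than the assignment model (A-STPRBH): for every STPRBH instance the LP relaxation values satisfy $\nu_{\text{P-STPRBH}}\le\nu_{\text{A-STPRBH}}$, and there exist STPRBH instances for which this inequality is strict.
   Context: STPRBH instance: a complete undirected graph $G=(V,E)$ with edge costs $c:E\to\mathbb{R}_{>0}$, node revenues $\rho:V\to\mathbb{R}_{\ge0}$, a root $r\in V$, a hop limit $H\ge1$ and a budget $B\ge0$. For every ordered pair $(u,v)$ of distinct nodes there is a variable $x_{u,v}$. Common $x$-constraints: (X1) $\sum_{u\neq v}x_{u,v}\le1$ for all $v\in V$; (X2) $\sum_{u\in V\setminus\{v,w\}}x_{u,v}\ge x_{v,w}$ for all $v\in V\setminus\{r\}$, $w\neq v$; (X3) $0\le x_{u,v}\le1$; (X5) $\sum_{uv\in E}c_{uv}(x_{u,v}+x_{v,u})\le B$. $\mathcal{P}^{STPRBH}$: all $(x,l,g)$ (with $l_{v,i},g_{i,v}$ for $v\in V$, $i=0,\dots,H$) satisfying (X1)–(X3),(X5) and $l_{r,0}=g_{0,r}=0$; $l_{v,1}=g_{H,v}=0$ for $v\neq r$; $l_{v,i}\le l_{v,i+1}$ and $g_{i,v}+l_{v,i+1}=1$ for $v\in V$, $i=0,\dots,H-1$; $l_{u,i}+g_{i,v}\ge x_{u,v}$ for $u\neq v$, $i=0,\dots,H$; $0\le l,g\le1$. $\mathcal{A}^{STPRBH}$: all $(x,y)$ (with $y_{v,i}$ for $v\in V$,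 $i=0,\dots,H$) satisfying (X1)–(X3),(X5) and $y_{r,0}=1$; $y_{r,i}=0$ for $i\ge1$; $y_{v,0}=0$ and $\sum_{i=1}^Hy_{v,i}=1$ for $v\neq r$; $y_{u,i}-y_{v,i+1}+x_{u,v}\le1$ for $u\neq v$, $i=0,\dots,H-1$; $y_{u,H}+x_{u,v}\le1$ for $u\neq v$; $0\le y\le1$. (A-STPRBH) and (P-STPRBH) maximize $\rho_r+\sum_{uv\in E}(x_{u,v}\rho_v+x_{v,u}\rho_u)$ over the integral points of $\mathcal{A}^{STPRBH}$ and $\mathcal{P}^{STPRBH}$ respectively. $\nu_M$ is the optimal value of the LP relaxation of ILP $M$. For a maximization problem, model $A$ is stronger than $B$ if $\nu_A\le\nu_B$ on all instances, and strictly stronger if moreover strict inequality holds for some instance. -}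

module Defs where

open import Algebra.Bundles using (CommutativeRing)
open import Algebra.Core using (Op₁; Op₂)
open import Algebra.Structures using (IsCommutativeRing)
import Algebra.Definitions.RawMonoid as RawMonoidDefinitions
import Algebra.Properties.CommutativeMonoid.Sum as Summation
import Algebra.Properties.Ring as RingProperties
open import Data.Bool.Base using (Bool; true; false; if_then_else_)
open import Data.Fin.Base using (Fin; zero; suc; inject₁; fromℕ; fromℕ<)
open import Data.Fin.Properties using (_≟_; _<?_; <⇒≢; fromℕ≢inject₁)
open import Data.Nat.Base as ℕ using (ℕ; s≤s)
open import Data.Product.Base using (∃; _×_; _,_; proj₁; proj₂)
open import Data.Sum.Base using (_⊎_; inj₁; inj₂)
open import Level using (_⊔_)
open import Relation.Binary.Bundles using (Poset)
open import Relation.Binary.Core using (Rel)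
open import Relation.Binary.PropositionalEquality.Core using (_≡_; _≢_; ≢-sym)
import Relation.Binary.PropositionalEquality.Core as ≡
open import Relation.Binary.Structures using (IsDecTotalOrder)
import Relation.Binary.Construct.NonStrictToStrict as ToStrict
import Relation.Binary.Reasoning.PartialOrder as PosetReasoning
open import Relation.Nullary.Decidable using (Dec; yes; no; does; ¬?; _×-dec_; dec-true; dec-false)
open import Relation.Nullary.Negation.Core using (¬_)
open import Relation.Unary using (Pred; Decidable; Satisfiable)

-- A Dedekind-complete ordered field.  Classically this determines the real
-- numbers up to isomorphism.

record Reals c ℓ₁ ℓ₂ : Set (Level.suc (c ⊔ ℓ₁ ⊔ ℓ₂)) where
  infix  8 -_
  infixl 7 _*_
  infixl 6 _+_ _-_
  infix  4 _≈_ _≤_ _≥_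

  field
    Carrier           : Set c
    _≈_               : Rel Carrier ℓ₁
    _≤_               : Rel Carrier ℓ₂
    _+_ _*_           : Op₂ Carrier
    -_                : Op₁ Carrier
    0# 1#             : Carrier
    isCommutativeRing : IsCommutativeRing _≈_ _+_ _*_ -_ 0# 1#
    0≉1               : ¬ (0# ≈ 1#)
    inverse           : ∀ x → ¬ (x ≈ 0#) → ∃ λ y → x * y ≈ 1#
    isDecTotalOrder   : IsDecTotalOrder _≈_ _≤_
    +-monoʳ-≤         : ∀ z {x y} → x ≤ y → z + x ≤ z + y
    *-nonneg          : ∀ {x y} → 0# ≤ x → 0# ≤ y → 0# ≤ x * y

  UpperBound : ∀ {s} → Pred Carrier s → Pred Carrier _
  UpperBound S b = ∀ a → S a → a ≤ b

  IsSupremum : ∀ {s} → Pred Carrier s → Pred Carrier _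
  IsSupremum S m = UpperBound S m × (∀ b → UpperBound S b → m ≤ b)

  field
    complete : (S : Pred Carrier (c ⊔ ℓ₁ ⊔ ℓ₂)) →
               ∃ S → ∃ (UpperBound S) → ∃ (IsSupremum S)

  commutativeRing : CommutativeRing c ℓ₁
  commutativeRing = record { isCommutativeRing = isCommutativeRing }

  poset : Poset c ℓ₁ ℓ₂
  poset = record { isPartialOrder = IsDecTotalOrder.isPartialOrder isDecTotalOrder }

  open ToStrict _≈_ _≤_ public using (_<_)

  _≥_ : Rel Carrier ℓ₂
  x ≥ y = y ≤ x

  _-_ : Op₂ Carrier
  x - y = x + - y

  open Summation (CommutativeRing.+-commutativeMonoid commutativeRing) public
    using (sum)

  sumOver : ∀ {n p} {P : Pred (Fin n) p} → Decidable P → (Fin n → Carrier) → Carrier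
  sumOver P? f = sum λ i → if does (P? i) then f i else 0#

  open RawMonoidDefinitions (CommutativeRing.+-rawMonoid commutativeRing)
    using () renaming (_×_ to _·_)

  IsInteger : Pred Carrier ℓ₁
  IsInteger x = ∃ λ (k : ℕ) → (x ≈ k · 1#) ⊎ (x ≈ - (k · 1#))

module RealsProperties {c ℓ₁ ℓ₂} (ℝ : Reals c ℓ₁ ℓ₂) where
  open Reals ℝ
  open CommutativeRing commutativeRing
    using ( refl; sym; trans; +-cong; +-congˡ; +-comm; +-identityˡ; +-identityʳ
          ; +-assoc; -‿inverseˡ; -‿inverseʳ; -‿cong; *-identityˡ; distribʳ
          ; +-commutativeMonoid; ring )
  open IsDecTotalOrder isDecTotalOrder public
    using (total) renaming (refl to ≤-refl; reflexive to ≤-reflexive; trans to ≤-trans)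
  open Summation +-commutativeMonoid using (sum-cong-≋; sum-replicate-zero)
  open RingProperties ring using (-‿distribˡ-*; -‿involutive)
  open PosetReasoning poset

  +-mono-≤ : ∀ {w x y z} → w ≤ x → y ≤ z → w + y ≤ x + z
  +-mono-≤ {w} {x} {y} {z} w≤x y≤z = begin
    w + y ≤⟨ +-monoʳ-≤ w y≤z ⟩
    w + z ≈⟨ +-comm w z ⟩
    z + w ≤⟨ +-monoʳ-≤ z w≤x ⟩
    z + x ≈⟨ +-comm z x ⟩
    x + z ∎

  x≤y⇒0≤y-x : ∀ {x y} → x ≤ y → 0# ≤ y - x
  x≤y⇒0≤y-x {x} {y} x≤y = begin
    0#    ≈⟨ -‿inverseʳ x ⟨
    x - x ≤⟨ +-mono-≤ x≤y ≤-refl ⟩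
    y - x ∎

  0≤y-x⇒x≤y : ∀ {x y} → 0# ≤ y - x → x ≤ y
  0≤y-x⇒x≤y {x} {y} 0≤y-x = begin
    x           ≈⟨ +-identityˡ x ⟨
    0# + x      ≤⟨ +-mono-≤ 0≤y-x ≤-refl ⟩
    y - x + x   ≈⟨ +-assoc y (- x) x ⟩
    y + (- x + x) ≈⟨ +-congˡ (-‿inverseˡ x) ⟩
    y + 0#      ≈⟨ +-identityʳ y ⟩
    y           ∎

  neg-nonpos : ∀ {x} → 0# ≤ x → - x ≤ 0#
  neg-nonpos {x} 0≤x = 0≤y-x⇒x≤y (begin
    0#         ≤⟨ 0≤x ⟩
    x          ≈⟨ -‿involutive x ⟨
    - (- x)    ≈⟨ +-identityˡ _ ⟨
    0# - (- x) ∎)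

  *-shrink : ∀ {x y} → x ≤ 1# → 0# ≤ y → x * y ≤ y
  *-shrink {x} {y} x≤1 0≤y = 0≤y-x⇒x≤y (begin
    0#               ≤⟨ *-nonneg (x≤y⇒0≤y-x x≤1) 0≤y ⟩
    (1# - x) * y     ≈⟨ distribʳ y 1# (- x) ⟩
    1# * y + - x * y ≈⟨ +-cong (*-identityˡ y) (sym (-‿distribˡ-* x y)) ⟩
    y - x * y        ∎)

  0≤1 : 0# ≤ 1#
  0≤1 with total 0# 1#
  ... | inj₁ 0≤1 = 0≤1
  ... | inj₂ 1≤0 = begin
    0#              ≤⟨ *-nonneg 0≤-1 0≤-1 ⟩
    - 1# * - 1#     ≈⟨ -‿distribˡ-* 1# (- 1#) ⟨
    - (1# * - 1#)   ≈⟨ -‿cong (*-identityˡ (- 1#)) ⟩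
    - (- 1#)        ≈⟨ -‿involutive 1# ⟩
    1#              ∎
    where
    0≤-1 : 0# ≤ - 1#
    0≤-1 = ≤-trans (x≤y⇒0≤y-x 1≤0) (≤-reflexive (+-identityˡ (- 1#)))

  sum-mono : ∀ {n} {f g : Fin n → Carrier} → (∀ i → f i ≤ g i) → sum f ≤ sum g
  sum-mono {ℕ.zero}  f≤g = ≤-refl
  sum-mono {ℕ.suc n} f≤g = +-mono-≤ (f≤g zero) (sum-mono λ i → f≤g (suc i))

  sum-zero : ∀ {n} {f : Fin n → Carrier} → (∀ i → f i ≈ 0#) → sum f ≈ 0#
  sum-zero {n} f≈0 = trans (sum-cong-≋ f≈0) (sum-replicate-zero n)

  sumOver-mono : ∀ {n p} {P : Pred (Fin n) p} (P? : Decidable P) {f g : Fin n → Carrier} →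
                 (∀ i → P i → f i ≤ g i) → sumOver P? f ≤ sumOver P? g
  sumOver-mono P? {f} {g} f≤g = sum-mono λ i → term i (P? i)
    where
    term : ∀ i (d : Dec _) →
           (if does d then f i else 0#) ≤ (if does d then g i else 0#)
    term i (yes p) = f≤g i p
    term i (no _)  = ≤-refl

  sumOver-zero : ∀ {n p} {P : Pred (Fin n) p} (P? : Decidable P) {f : Fin n → Carrier} →
                 (∀ i → f i ≈ 0#) → sumOver P? f ≈ 0#
  sumOver-zero P? {f} f≈0 = sum-zero λ i → term i (does (P? i))
    where
    term : ∀ i b → (if b then f i else 0#) ≈ 0#
    term i true  = f≈0 i
    term i false = refl

module STPRBH {c ℓ₁ ℓ₂} (ℝ : Reals c ℓ₁ ℓ₂) where
  open Reals ℝ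

  -- Integrality plays no role in `ν`, the supremum of the objective over the
  -- polyhedron; `feasible` and `bounded` guarantee that this supremum exists.

  record MaxILP : Set (Level.suc (c ⊔ ℓ₁ ⊔ ℓ₂)) where
    field
      Point      : Set c
      Polyhedron : Pred Point (ℓ₁ ⊔ ℓ₂)
      Integral   : Pred Point ℓ₁
      objective  : Point → Carrier
      feasible   : Satisfiable Polyhedron
      bounded    : ∃ λ b → ∀ z → Polyhedron z → objective z ≤ b

    RelaxationValue : Pred Carrier (c ⊔ ℓ₁ ⊔ ℓ₂)
    RelaxationValue a = ∃ λ z → Polyhedron z × objective z ≈ a

  ν-exists : (M : MaxILP) → ∃ (IsSupremum (MaxILP.RelaxationValue M))
  ν-exists M = complete RelaxationValue
    (objective (proj₁ feasible) , proj₁ feasible , proj₂ feasible , refl)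
    (proj₁ bounded , λ { a (z , z∈P , eq) → ≤-respˡ-≈ eq (proj₂ bounded z z∈P) })
    where
    open MaxILP M
    open CommutativeRing commutativeRing using (refl)
    open IsDecTotalOrder isDecTotalOrder using (≤-respˡ-≈)

  ν : MaxILP → Carrier
  ν M = proj₁ (ν-exists M)

  -- The nodes are Fin n.  An edge uv is represented by its ordering with u < v,
  -- and diagonal values of costs and of the variables x are never used.

  record Instance : Set (c ⊔ ℓ₁ ⊔ ℓ₂) where
    field
      n         : ℕ
      root      : Fin n
      cost      : Fin n → Fin n → Carrier
      cost-sym  : ∀ u v → cost u v ≈ cost v u
      cost-pos  : ∀ u v → u ≢ v → 0# < cost u v
      revenue   : Fin n → Carrier
      revenue≥0 : ∀ v → revenue v ≥ 0#
      H         : ℕ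
      1≤H       : 1 ℕ.≤ H
      B         : Carrier
      B≥0       : B ≥ 0#

  module _ (I : Instance) where
    open Instance I

    V : Set
    V = Fin n

    Layer : Set
    Layer = Fin (ℕ.suc H)

    first last : Layer
    first = fromℕ< (s≤s 1≤H)
    last  = fromℕ H

    edgeSum : (V → V → Carrier) → Carrier
    edgeSum f = sum λ u → sumOver (λ v → u <? v) (f u)

    revenueCollected : (V → V → Carrier) → Carrier
    revenueCollected x =
      revenue root + edgeSum λ u v → x u v * revenue v + x v u * revenue u

    record CommonConstraints (x : V → V → Carrier) : Set (ℓ₁ ⊔ ℓ₂) where
      field
        X1 : ∀ v → sumOver (λ u → ¬? (u ≟ v)) (λ u → x u v) ≤ 1#
        X2 : ∀ v w → v ≢ root → w ≢ v →
             sumOver (λ u → ¬? (u ≟ v) ×-dec ¬? (u ≟ w)) (λ u → x u v) ≥ x v w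
        X3 : ∀ u v → u ≢ v → (0# ≤ x u v) × (x u v ≤ 1#)
        X5 : edgeSum (λ u v → cost u v * (x u v + x v u)) ≤ B

    record P-Point : Set c where
      field
        x : V → V → Carrier
        l : V → Layer → Carrier
        g : Layer → V → Carrier

    record P-Polyhedron (z : P-Point) : Set (ℓ₁ ⊔ ℓ₂) where
      open P-Point z
      field
        common  : CommonConstraints x
        l-root  : l root zero ≈ 0#
        g-root  : g zero root ≈ 0#
        l-first : ∀ v → v ≢ root → l v first ≈ 0#
        g-last  : ∀ v → v ≢ root → g last v ≈ 0#
        l-mono  : ∀ v (i : Fin H) → l v (inject₁ i) ≤ l v (suc i)
        g+l     : ∀ v (i : Fin H) → g (inject₁ i) v + l v (suc i) ≈ 1#
        l+g≥x   : ∀ u v i → u ≢ v → l u i + g i v ≥ x u v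
        l-range : ∀ v i → (0# ≤ l v i) × (l v i ≤ 1#)
        g-range : ∀ i v → (0# ≤ g i v) × (g i v ≤ 1#)

    P-Integral : Pred P-Point ℓ₁
    P-Integral z = (∀ u v → u ≢ v → IsInteger (x u v))
                 × (∀ v i → IsInteger (l v i))
                 × (∀ i v → IsInteger (g i v))
      where open P-Point z

    record A-Point : Set c where
      field
        x : V → V → Carrier
        y : V → Layer → Carrier

    record A-Polyhedron (z : A-Point) : Set (ℓ₁ ⊔ ℓ₂) where
      open A-Point z
      field
        common    : CommonConstraints x
        y-root₀   : y root zero ≈ 1#
        y-root₊   : ∀ (i : Fin H) → y root (suc i) ≈ 0#
        y-zero    : ∀ v → v ≢ root → y v zero ≈ 0#
        y-sum     : ∀ v → v ≢ root → sum (λ (i : Fin H) → y v (suc i)) ≈ 1#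
        y-step    : ∀ u v (i : Fin H) → u ≢ v →
                    y u (inject₁ i) - y v (suc i) + x u v ≤ 1#
        y-last    : ∀ u v → u ≢ v → y u last + x u v ≤ 1#
        y-range   : ∀ v i → (0# ≤ y v i) × (y v i ≤ 1#)

    A-Integral : Pred A-Point ℓ₁
    A-Integral z = (∀ u v → u ≢ v → IsInteger (x u v))
                 × (∀ v i → IsInteger (y v i))
      where open A-Point z

  module _ (I : Instance) where
    open Instance I
    open RealsProperties ℝ
    open CommutativeRing commutativeRing
      using (refl; sym; trans; +-identityˡ; +-identityʳ; +-congˡ; *-congˡ; *-identityˡ; zeroʳ)
    open PosetReasoning poset

    revenueCollected-bounded : ∀ x → CommonConstraints I x →
      revenueCollected I x ≤ revenueCollected I (λ _ _ → 1#)
    revenueCollected-bounded x cc = +-monoʳ-≤ (revenue root)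
      (sum-mono λ u → sumOver-mono (u <?_) λ v u<v →
        +-mono-≤ (bound u v (<⇒≢ u<v)) (bound v u (≢-sym (<⇒≢ u<v))))
      where
      bound : ∀ u v → u ≢ v → x u v * revenue v ≤ 1# * revenue v
      bound u v u≢v = begin
        x u v * revenue v ≤⟨ *-shrink (proj₂ (CommonConstraints.X3 cc u v u≢v)) (revenue≥0 v) ⟩
        revenue v         ≈⟨ *-identityˡ (revenue v) ⟨
        1# * revenue v    ∎

    zero-common : CommonConstraints I (λ _ _ → 0#)
    zero-common = record
      { X1 = λ v → ≤-trans (≤-reflexive (sumOver-zero (λ u → ¬? (u ≟ v)) λ _ → refl)) 0≤1
      ; X2 = λ v w _ _ → ≤-reflexive (sym
               (sumOver-zero (λ u → ¬? (u ≟ v) ×-dec ¬? (u ≟ w)) λ _ → refl))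
      ; X3 = λ _ _ _ → ≤-refl , 0≤1
      ; X5 = ≤-trans (≤-reflexive (sum-zero λ u → sumOver-zero (u <?_) λ v →
               trans (*-congˡ (+-identityˡ 0#)) (zeroʳ (cost u v)))) B≥0
      }

    private
      bit : Bool → Carrier
      bit b = if b then 1# else 0#

      bit-range : ∀ b → (0# ≤ bit b) × (bit b ≤ 1#)
      bit-range true  = 0≤1 , ≤-refl
      bit-range false = ≤-refl , 0≤1

      at : ∀ {a} (P : Bool → Set a) {b b′} → b ≡ b′ → P b′ → P b
      at P eq = ≡.subst P (≡.sym eq)

      isRoot : Fin n → Bool
      isRoot v = does (v ≟ root)

      isRoot-root : isRoot root ≡ true
      isRoot-root = dec-true (root ≟ root) ≡.refl

      isRoot-other : ∀ {v} → v ≢ root → isRoot v ≡ false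
      isRoot-other {v} = dec-false (v ≟ root)

    P-feasible : Satisfiable (P-Polyhedron I)
    P-feasible = record { x = λ _ _ → 0# ; l = λ v i → bit (l (isRoot v) i)
                        ; g = λ i v → bit (g (isRoot v) i) } , record
      { common  = zero-common
      ; l-root  = at (λ b → bit (l b zero) ≈ 0#) isRoot-root refl
      ; g-root  = at (λ b → bit (g b zero) ≈ 0#) isRoot-root refl
      ; l-first = λ v v≢r → at (λ b → bit (l b (first I)) ≈ 0#) (isRoot-other v≢r) refl
      ; g-last  = λ v v≢r → at (λ b → bit (g b (last I)) ≈ 0#) (isRoot-other v≢r) g-last
      ; l-mono  = λ v i → mono (isRoot v) i
      ; g+l     = λ v i → g+l (isRoot v) i
      ; l+g≥x   = λ u v i _ → ≤-trans (≤-reflexive (sym (+-identityˡ 0#)))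
                    (+-mono-≤ (proj₁ (bit-range (l (isRoot u) i)))
                              (proj₁ (bit-range (g (isRoot v) i))))
      ; l-range = λ v i → bit-range (l (isRoot v) i)
      ; g-range = λ i v → bit-range (g (isRoot v) i)
      }
      where
      l g : Bool → Fin (ℕ.suc H) → Bool
      l true  zero    = false
      l true  (suc _) = true
      l false _       = false
      g true  _ = false
      g false i = does (¬? (i ≟ last I))

      g-last : bit (g false (last I)) ≈ 0#
      g-last rewrite dec-true (last I ≟ last I) ≡.refl = refl

      mono : ∀ b (i : Fin H) → bit (l b (inject₁ i)) ≤ bit (l b (suc i))
      mono true  i = proj₂ (bit-range (l true (inject₁ i)))
      mono false _ = ≤-refl

      g+l : ∀ b (i : Fin H) → bit (g b (inject₁ i)) + bit (l b (suc i)) ≈ 1#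
      g+l true  i = +-identityˡ 1#
      g+l false i rewrite dec-false (inject₁ i ≟ last I) (λ eq → fromℕ≢inject₁ (≡.sym eq)) =
        +-identityʳ 1#

    A-feasible : Satisfiable (A-Polyhedron I)
    A-feasible = record { x = λ _ _ → 0# ; y = λ v i → bit (y (isRoot v) i) } , record
      { common  = zero-common
      ; y-root₀ = at (λ b → bit (y {H} b zero) ≈ 1#) isRoot-root refl
      ; y-root₊ = λ i → at (λ b → bit (y b (suc i)) ≈ 0#) isRoot-root refl
      ; y-zero  = λ v v≢r → at (λ b → bit (y {H} b zero) ≈ 0#) (isRoot-other v≢r) refl
      ; y-sum   = λ v v≢r → at (λ b → sum (λ (i : Fin H) → bit (y b (suc i))) ≈ 1#)
                               (isRoot-other v≢r) (y-sum 1≤H)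
      ; y-step  = λ u v i _ → begin
          bit (y (isRoot u) (inject₁ i)) - bit (y (isRoot v) (suc i)) + 0#
            ≈⟨ +-identityʳ _ ⟩
          bit (y (isRoot u) (inject₁ i)) - bit (y (isRoot v) (suc i))
            ≤⟨ +-mono-≤ (proj₂ (bit-range (y (isRoot u) (inject₁ i))))
                        (neg-nonpos (proj₁ (bit-range (y (isRoot v) (suc i))))) ⟩
          1# + 0#
            ≈⟨ +-identityʳ 1# ⟩
          1# ∎
      ; y-last  = λ u v _ → ≤-trans (≤-reflexive (+-identityʳ _))
                              (proj₂ (bit-range (y (isRoot u) (last I))))
      ; y-range = λ v i → bit-range (y (isRoot v) i)
      }
      where
      y : ∀ {k} → Bool → Fin (ℕ.suc k) → Bool
      y true  zero          = true
      y true  (suc _)       = false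
      y false zero          = false
      y false (suc zero)    = true
      y false (suc (suc _)) = false

      y-sum : ∀ {k} → 1 ℕ.≤ k → sum (λ (i : Fin k) → bit (y false (suc i))) ≈ 1#
      y-sum (s≤s {n = k} _) = trans (+-congˡ (sum-zero {k} λ _ → refl)) (+-identityʳ 1#)

  P-STPRBH : Instance → MaxILP
  P-STPRBH I = record
    { Point      = P-Point I
    ; Polyhedron = P-Polyhedron I
    ; Integral   = P-Integral I
    ; objective  = λ z → revenueCollected I (P-Point.x z)
    ; feasible   = P-feasible I
    ; bounded    = revenueCollected I (λ _ _ → 1#) , λ z z∈P →
                     revenueCollected-bounded I (P-Point.x z) (P-Polyhedron.common z∈P)
    }

  A-STPRBH : Instance → MaxILP
  A-STPRBH I = record
    { Point      = A-Point I
    ; Polyhedron = A-Polyhedron I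
    ; Integral   = A-Integral I
    ; objective  = λ z → revenueCollected I (A-Point.x z)
    ; feasible   = A-feasible I
    ; bounded    = revenueCollected I (λ _ _ → 1#) , λ z z∈A →
                     revenueCollected-bounded I (A-Point.x z) (A-Polyhedron.common z∈A)
    }

  Model : Set (Level.suc (c ⊔ ℓ₁ ⊔ ℓ₂))
  Model = Instance → MaxILP

  _StrongerThan_ : Model → Model → Set (c ⊔ ℓ₁ ⊔ ℓ₂)
  M StrongerThan N = ∀ I → ν (M I) ≤ ν (N I)

  _StrictlyStrongerThan_ : Model → Model → Set (c ⊔ ℓ₁ ⊔ ℓ₂)
  M StrictlyStrongerThan N = M StrongerThan N × ∃ λ I → ν (M I) < ν (N I)

{-# OPTIONS --safe #-}
module Submission where

open import Defs

open import Algebra.Bundles using (CommutativeRing)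
import Algebra.Construct.NaturalChoice.Min as Minimum
import Algebra.Properties.Semiring.Sum as SemiringSum
import Algebra.Solver.Ring.NaturalCoefficients.Default as SemiringSolver
open import Data.Bool.Base using (true; false; if_then_else_)
open import Data.Empty using (⊥-elim)
open import Data.Fin.Base using (Fin; zero; suc; inject₁; fromℕ)
open import Data.Fin.Patterns using (0F; 1F; 2F)
open import Data.Fin.Properties using (_≟_; _<?_; <⇒≢)
open import Data.Nat.Base as ℕ using (ℕ; z≤n; s≤s)
open import Data.Product.Base using (∃; _×_; _,_; proj₁; proj₂)
open import Data.Sum.Base using (inj₁; inj₂)
open import Function.Base using (_∘_)
open import Level using (Lift; lift; _⊔_)
open import Relation.Binary.Bundles using (TotalOrder)
open import Relation.Binary.PropositionalEquality.Core using (_≡_; _≢_; ≢-sym)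
import Relation.Binary.PropositionalEquality.Core as ≡
import Relation.Binary.Reasoning.PartialOrder as PosetReasoning
open import Relation.Binary.Structures using (IsDecTotalOrder)
open import Relation.Nullary.Decidable using (Dec; yes; no; does; ¬?; _×-dec_)
open import Relation.Nullary.Negation.Core using (¬_)
open import Relation.Unary using (Pred; Decidable)

-- Let (x , l , g) be P-feasible.  Starting from any assignment y with y + l ≤ 1,
-- repeatedly move, for every arc uv, the fraction x u v of the mass in layer i of
-- u to layer i + 1 of v, truncate so that y + l ≤ 1 persists, and return to the
-- first layer what is missing.  Since x u v ≤ l u i + 1 - l v (i + 1), consecutive
-- iterates satisfy y u i + x u v ≤ 1 + y′ v (i + 1).  A fixed point would be
-- A-feasible for x; averaging the first k + 1 iterates instead gives a point that
-- is exactly A-feasible for k / (k + 1) x, and k → ∞ yields the inequality.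

-- Arithmetic, finite sums and the Archimedean argument in a complete ordered field.

module OrderedField {c ℓ₁ ℓ₂} (ℝ : Reals c ℓ₁ ℓ₂) where
  open Reals ℝ
  open RealsProperties ℝ public
  open CommutativeRing commutativeRing public
    using ( refl; sym; trans; +-cong; +-congˡ; +-congʳ; +-comm; +-identityˡ; +-identityʳ
          ; +-assoc; -‿inverseˡ; -‿inverseʳ; *-congˡ; *-congʳ; *-comm; *-assoc
          ; *-identityˡ; *-identityʳ; zeroˡ; zeroʳ; distribˡ; distribʳ
          ; semiring; commutativeSemiring )
  open IsDecTotalOrder isDecTotalOrder public using (antisym)
  open SemiringSum semiring public using (*-distribˡ-sum; ∑-distrib-+; ∑-comm; sum-cong-≋; sum-init-last)
  open SemiringSolver commutativeSemiring public using (solve; _:=_; _:+_; _:*_; con)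
  open PosetReasoning poset

  totalOrder : TotalOrder c ℓ₁ ℓ₂
  totalOrder = record { isTotalOrder = IsDecTotalOrder.isTotalOrder isDecTotalOrder }

  open Minimum totalOrder public using (_⊓_; x⊓y≤x; x⊓y≤y; ⊓-glb)

  ι : ℕ → Carrier
  ι ℕ.zero    = 0#
  ι (ℕ.suc k) = ι k + 1#

  +-monoˡ-≤ : ∀ z {x y} → x ≤ y → x + z ≤ y + z
  +-monoˡ-≤ z x≤y = +-mono-≤ x≤y ≤-refl

  +-cancelʳ-≤ : ∀ z {x y} → x + z ≤ y + z → x ≤ y
  +-cancelʳ-≤ z {x} {y} x+z≤y+z = begin
    x             ≈⟨ x+z-z≈x x ⟨
    x + z - z     ≤⟨ +-monoˡ-≤ (- z) x+z≤y+z ⟩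
    y + z - z     ≈⟨ x+z-z≈x y ⟩
    y             ∎
    where
    x+z-z≈x : ∀ x → x + z - z ≈ x
    x+z-z≈x x = trans (+-assoc x z (- z)) (trans (+-congˡ (-‿inverseʳ z)) (+-identityʳ x))

  x-z+z≈x : ∀ x z → x - z + z ≈ x
  x-z+z≈x x z = trans (+-assoc x (- z) z) (trans (+-congˡ (-‿inverseˡ z)) (+-identityʳ x))

  x≤y+z⇒x-z≤y : ∀ {x y z} → x ≤ y + z → x - z ≤ y
  x≤y+z⇒x-z≤y {x} {y} {z} x≤y+z =
    +-cancelʳ-≤ z (≤-trans (≤-reflexive (x-z+z≈x x z)) x≤y+z)

  x+z≤y⇒x≤y-z : ∀ {x y z} → x + z ≤ y → x ≤ y - z
  x+z≤y⇒x≤y-z {x} {y} {z} x+z≤y =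
    +-cancelʳ-≤ z (≤-trans x+z≤y (≤-reflexive (sym (x-z+z≈x y z))))

  x≤y-z⇒x+z≤y : ∀ {x y z} → x ≤ y - z → x + z ≤ y
  x≤y-z⇒x+z≤y {x} {y} {z} x≤y-z =
    ≤-trans (+-monoˡ-≤ z x≤y-z) (≤-reflexive (x-z+z≈x y z))

  +-nonneg : ∀ {x y} → 0# ≤ x → 0# ≤ y → 0# ≤ x + y
  +-nonneg 0≤x 0≤y = ≤-trans (≤-reflexive (sym (+-identityˡ 0#))) (+-mono-≤ 0≤x 0≤y)

  x≤x+y : ∀ {x y} → 0# ≤ y → x ≤ x + y
  x≤x+y {x} 0≤y = ≤-trans (≤-reflexive (sym (+-identityʳ x))) (+-monoʳ-≤ x 0≤y)

  *-monoʳ-≤ : ∀ {z x y} → 0# ≤ z → x ≤ y → z * x ≤ z * y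
  *-monoʳ-≤ {z} {x} {y} 0≤z x≤y = begin
    z * x                 ≤⟨ x≤x+y (*-nonneg 0≤z (x≤y⇒0≤y-x x≤y)) ⟩
    z * x + z * (y - x)   ≈⟨ distribˡ z x (y - x) ⟨
    z * (x + (y - x))     ≈⟨ *-congˡ (trans (+-comm x (y - x)) (x-z+z≈x y x)) ⟩
    z * y                 ∎

  ι-nonneg : ∀ k → 0# ≤ ι k
  ι-nonneg ℕ.zero    = ≤-refl
  ι-nonneg (ℕ.suc k) = +-nonneg (ι-nonneg k) 0≤1

  ι-suc≉0 : ∀ k → ¬ (ι (ℕ.suc k) ≈ 0#)
  ι-suc≉0 k eq = 0≉1 (antisym 0≤1 (begin
    1#         ≤⟨ x≤x+y (ι-nonneg k) ⟩
    1# + ι k   ≈⟨ +-comm 1# (ι k) ⟩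
    ι k + 1#   ≈⟨ eq ⟩
    0#         ∎))

  reciprocal-nonneg : ∀ {x y} → 0# ≤ x → x * y ≈ 1# → 0# ≤ y
  reciprocal-nonneg {x} {y} 0≤x xy≈1 with total 0# y
  ... | inj₁ 0≤y = 0≤y
  ... | inj₂ y≤0 = ⊥-elim (0≉1 (antisym 0≤1 (begin
    1#     ≈⟨ xy≈1 ⟨
    x * y  ≤⟨ *-monoʳ-≤ 0≤x y≤0 ⟩
    x * 0# ≈⟨ zeroʳ x ⟩
    0#     ∎)))

  -- If s is the supremum of the multiples of e, then s - e is an upper bound too.
  multiples-bounded⇒nonpos : ∀ {e b} → (∀ k → ι k * e ≤ b) → e ≤ 0#
  multiples-bounded⇒nonpos {e} {b} bounded =
    +-cancelʳ-≤ s (≤-trans e+s≤s (≤-reflexive (sym (+-identityˡ s))))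
    where
    Multiple : Pred Carrier (c ⊔ ℓ₁ ⊔ ℓ₂)
    Multiple a = Lift (c ⊔ ℓ₂) (∃ λ k → a ≈ ι k * e)

    supremum : ∃ (IsSupremum Multiple)
    supremum = complete Multiple (0# * e , lift (0 , refl))
      (b , λ { a (lift (k , a≈ke)) → ≤-trans (≤-reflexive a≈ke) (bounded k) })

    s : Carrier
    s = proj₁ supremum

    s≤s-e : s ≤ s - e
    s≤s-e = proj₂ (proj₂ supremum) (s - e) λ { a (lift (k , a≈ke)) → x+z≤y⇒x≤y-z (begin
      a + e             ≈⟨ +-cong a≈ke (sym (*-identityˡ e)) ⟩
      ι k * e + 1# * e  ≈⟨ distribʳ e (ι k) 1# ⟨
      (ι k + 1#) * e    ≤⟨ proj₁ (proj₂ supremum) _ (lift (ℕ.suc k , refl)) ⟩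
      s                 ∎) }

    e+s≤s : e + s ≤ s
    e+s≤s = ≤-trans (≤-reflexive (+-comm e s)) (x≤y-z⇒x+z≤y s≤s-e)

  sum-nonneg : ∀ {n} {f : Fin n → Carrier} → (∀ i → 0# ≤ f i) → 0# ≤ sum f
  sum-nonneg {n} 0≤f =
    ≤-trans (≤-reflexive (sym (sum-zero {n} {λ _ → 0#} λ _ → refl))) (sum-mono 0≤f)

  term≤sum : ∀ {n} {f : Fin n → Carrier} → (∀ i → 0# ≤ f i) → ∀ i → f i ≤ sum f
  term≤sum 0≤f zero    = x≤x+y (sum-nonneg (0≤f ∘ suc))
  term≤sum {f = f} 0≤f (suc i) = begin
    f (suc i)                ≤⟨ term≤sum (0≤f ∘ suc) i ⟩
    sum (f ∘ suc)            ≤⟨ x≤x+y (0≤f zero) ⟩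
    sum (f ∘ suc) + f zero   ≈⟨ +-comm _ (f zero) ⟩
    sum f                    ∎

  sum-inject₁≤sum : ∀ {n} (f : Fin (ℕ.suc n) → Carrier) → 0# ≤ f (fromℕ n) →
                    sum (f ∘ inject₁) ≤ sum f
  sum-inject₁≤sum f 0≤last = ≤-trans (x≤x+y 0≤last) (≤-reflexive (sym (sum-init-last f)))

  term≤sumOver : ∀ {n p} {P : Pred (Fin n) p} (P? : Decidable P) {f : Fin n → Carrier} →
                 (∀ i → P i → 0# ≤ f i) → ∀ i → P i → f i ≤ sumOver P? f
  term≤sumOver P? {f} 0≤f i p =
    ≤-trans (own (P? i)) (term≤sum (λ j → nonneg j (P? j)) i)
    where
    nonneg : ∀ j (d : Dec _) → 0# ≤ (if does d then f j else 0#)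
    nonneg j (yes p) = 0≤f j p
    nonneg j (no _)  = ≤-refl

    own : (d : Dec _) → f i ≤ (if does d then f i else 0#)
    own (yes _) = ≤-refl
    own (no ¬p) = ⊥-elim (¬p p)

  *-distribˡ-sumOver : ∀ {n p} {P : Pred (Fin n) p} (P? : Decidable P) z (f : Fin n → Carrier) →
                       z * sumOver P? f ≈ sumOver P? (λ i → z * f i)
  *-distribˡ-sumOver P? z f =
    trans (*-distribˡ-sum z (λ i → if does (P? i) then f i else 0#))
          (sum-cong-≋ λ i → term i (does (P? i)))
    where
    term : ∀ i b → z * (if b then f i else 0#) ≈ (if b then z * f i else 0#)
    term i true  = refl
    term i false = zeroʳ z

  stepwise-mono : ∀ {k} (f : Fin (ℕ.suc k) → Carrier) →
                  (∀ i → f (inject₁ i) ≤ f (suc i)) → ∀ i → f zero ≤ f i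
  stepwise-mono f mono zero = ≤-refl
  stepwise-mono {ℕ.suc k} f mono (suc i) =
    ≤-trans (mono zero) (stepwise-mono (f ∘ suc) (mono ∘ suc) i)

-- From an ordering to averaged assignments.

module Averaging {c ℓ₁ ℓ₂} (ℝ : Reals c ℓ₁ ℓ₂) where
  open Reals ℝ
  open OrderedField ℝ
  open PosetReasoning poset

  -- Layers are 0 , … , h + 1.  Of the P-relaxation only x and l are needed.
  module FromOrdering (n h : ℕ) (root : Fin n)
    (x : Fin n → Fin n → Carrier) (l : Fin n → Fin (ℕ.suc (ℕ.suc h)) → Carrier)
    (x≥0     : ∀ u v → u ≢ v → 0# ≤ x u v)
    (x≤1     : ∀ u v → u ≢ v → x u v ≤ 1#)
    (indeg≤1 : ∀ v → sumOver (λ u → ¬? (u ≟ v)) (λ u → x u v) ≤ 1#)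
    (0≤l     : ∀ v i → 0# ≤ l v i)
    (l≤1     : ∀ v i → l v i ≤ 1#)
    (l-zero  : ∀ v → l v zero ≈ 0#)
    (l-first : ∀ v → v ≢ root → l v (suc zero) ≈ 0#)
    (l-root  : ∀ i → l root (suc i) ≈ 1#)
    (l-step  : ∀ u v i → u ≢ v → l v (suc i) + x u v ≤ 1# + l u (inject₁ i))
    where

    V Layer : Set
    V     = Fin n
    Layer = Fin (ℕ.suc (ℕ.suc h))

    -- The size `s` makes the conditions homogeneous, so sums of iterates and their rescalings stay
    -- within one record. The field `cap` is the bound `y + l ≤ 1` at size `s`.
    record Assignment (s : Carrier) (y : V → Layer → Carrier) : Set (ℓ₁ ⊔ ℓ₂) where
      field
        root₀  : y root zero ≈ s
        other₀ : ∀ v → v ≢ root → y v zero ≈ 0#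
        nonneg : ∀ v i → 0# ≤ y v i
        cap    : ∀ v i → y v i + s * l v i ≤ s
        mass   : ∀ v → sum (y v) ≈ s

    open Assignment

    add : ∀ {s t y z} → Assignment s y → Assignment t z →
          Assignment (s + t) (λ v i → y v i + z v i)
    add {s} {t} {y} {z} Y Z = record
      { root₀  = +-cong (root₀ Y) (root₀ Z)
      ; other₀ = λ v v≢r → trans (+-cong (other₀ Y v v≢r) (other₀ Z v v≢r)) (+-identityˡ 0#)
      ; nonneg = λ v i → +-nonneg (nonneg Y v i) (nonneg Z v i)
      ; cap    = λ v i → begin
          (y v i + z v i) + (s + t) * l v i
            ≈⟨ solve 5 (λ y z s t l → (y :+ z) :+ (s :+ t) :* l
                                   := (y :+ s :* l) :+ (z :+ t :* l)) refl (y v i) (z v i) s t (l v i) ⟩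
          (y v i + s * l v i) + (z v i + t * l v i)
            ≤⟨ +-mono-≤ (cap Y v i) (cap Z v i) ⟩
          s + t ∎
      ; mass   = λ v → trans (∑-distrib-+ (y v) (z v)) (+-cong (mass Y v) (mass Z v))
      }

    scale : ∀ {w s y} → 0# ≤ w → Assignment s y → Assignment (w * s) (λ v i → w * y v i)
    scale {w} {s} {y} 0≤w Y = record
      { root₀  = *-congˡ (root₀ Y)
      ; other₀ = λ v v≢r → trans (*-congˡ (other₀ Y v v≢r)) (zeroʳ w)
      ; nonneg = λ v i → *-nonneg 0≤w (nonneg Y v i)
      ; cap    = λ v i → begin
          w * y v i + (w * s) * l v i ≈⟨ +-congˡ (*-assoc w s (l v i)) ⟩
          w * y v i + w * (s * l v i) ≈⟨ distribˡ w (y v i) (s * l v i) ⟨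
          w * (y v i + s * l v i)     ≤⟨ *-monoʳ-≤ 0≤w (cap Y v i) ⟩
          w * s                       ∎
      ; mass   = λ v → trans (sym (*-distribˡ-sum w (y v))) (*-congˡ (mass Y v))
      }

    cap₁ : ∀ {y} → Assignment 1# y → ∀ v i → y v i + l v i ≤ 1#
    cap₁ Y v i = ≤-trans (+-monoʳ-≤ _ (≤-reflexive (sym (*-identityˡ (l v i))))) (cap Y v i)

    ≤1 : ∀ {y} → Assignment 1# y → ∀ v i → y v i ≤ 1#
    ≤1 Y v i = ≤-trans (x≤x+y (0≤l v i)) (cap₁ Y v i)

    -- The value `l v (suc zero)` is 1 at the root and 0 elsewhere, so it serves as the indicator of
    -- the root without a case split: the root sits in layer 0 and every other node in layer 1.
    initial : V → Layer → Carrier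
    initial v zero          = l v (suc zero)
    initial v (suc zero)    = 1# - l v (suc zero)
    initial v (suc (suc i)) = 0#

    initial-assignment : Assignment 1# initial
    initial-assignment = record
      { root₀  = l-root zero
      ; other₀ = l-first
      ; nonneg = λ { v zero → 0≤l v _ ; v (suc zero) → x≤y⇒0≤y-x (l≤1 v _) ; v (suc (suc i)) → ≤-refl }
      ; cap    = λ v i → ≤-trans (+-monoʳ-≤ _ (≤-reflexive (*-identityˡ (l v i)))) (initial-cap v i)
      ; mass   = λ v → trans (+-congˡ (trans (+-congˡ (sum-zero {h} λ _ → refl)) (+-identityʳ _)))
                         (trans (+-comm _ _) (x-z+z≈x 1# (l v (suc zero))))
      }
      where
      initial-cap : ∀ v i → initial v i + l v i ≤ 1#
      initial-cap v zero = begin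
        l v (suc zero) + l v zero ≈⟨ +-congˡ (l-zero v) ⟩
        l v (suc zero) + 0#       ≈⟨ +-identityʳ _ ⟩
        l v (suc zero)            ≤⟨ l≤1 v _ ⟩
        1#                        ∎
      initial-cap v (suc zero)    = ≤-reflexive (x-z+z≈x 1# _)
      initial-cap v (suc (suc i)) = ≤-trans (≤-reflexive (+-identityˡ _)) (l≤1 v _)

    -- Mass flowing into layer i + 1 of v along the arcs, truncated so that the
    -- bound y + l ≤ 1 survives.
    inflow moved : (V → Layer → Carrier) → V → Fin (ℕ.suc h) → Carrier
    inflow y v i = sumOver (λ u → ¬? (u ≟ v)) (λ u → x u v * y u (inject₁ i))
    moved  y v i = inflow y v i ⊓ (1# - l v (suc i))

    rest : (V → Layer → Carrier) → V → Carrier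
    rest y v = 1# - (y v zero + sum (moved y v))

    push : (V → Layer → Carrier) → V → Layer → Carrier
    push y v zero          = y v zero
    push y v (suc zero)    = moved y v zero + rest y v
    push y v (suc (suc i)) = moved y v (suc i)

    -- One redistribution step preserves assignments.

    module _ {y} (Y : Assignment 1# y) where
      inflow-nonneg : ∀ v i → 0# ≤ inflow y v i
      inflow-nonneg v i = ≤-trans (≤-reflexive (sym (sumOver-zero (λ u → ¬? (u ≟ v)) λ _ → refl)))
        (sumOver-mono (λ u → ¬? (u ≟ v)) λ u u≢v → *-nonneg (x≥0 u v u≢v) (nonneg Y u _))

      moved-nonneg : ∀ v i → 0# ≤ moved y v i
      moved-nonneg v i = ⊓-glb (inflow-nonneg v i) (x≤y⇒0≤y-x (l≤1 v _))

      moved-cap : ∀ v i → moved y v i + l v (suc i) ≤ 1#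
      moved-cap v i = x≤y-z⇒x+z≤y (x⊓y≤y _ _)

      -- After exchanging the sums, each arc `uv` contributes `x u v` times mass of `u`, hence at
      -- most `x u v`, and the in-degree bound finishes.
      sum-inflow≤1 : ∀ v → sum (inflow y v) ≤ 1#
      sum-inflow≤1 v = begin
        sum (inflow y v)                                ≈⟨ ∑-comm (λ i u → term u i (¬? (u ≟ v))) ⟩
        (sum λ u → sum λ i → term u i (¬? (u ≟ v)))     ≤⟨ sum-mono (λ u → arc u (¬? (u ≟ v))) ⟩
        sumOver (λ u → ¬? (u ≟ v)) (λ u → x u v)        ≤⟨ indeg≤1 v ⟩
        1#                                              ∎
        where
        term : ∀ u i → Dec (u ≢ v) → Carrier
        term u i d = if does d then x u v * y u (inject₁ i) else 0#

        arc : ∀ u (d : Dec (u ≢ v)) → (sum λ i → term u i d) ≤ (if does d then x u v else 0#)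
        arc u (yes u≢v) = begin
          (sum λ i → x u v * y u (inject₁ i)) ≈⟨ *-distribˡ-sum (x u v) (y u ∘ inject₁) ⟨
          -- Mass in the last layer of `u` is never sent on, so the sum over `inject₁` may fall
          -- short of the full mass.
          x u v * sum (y u ∘ inject₁)         ≤⟨ *-monoʳ-≤ (x≥0 u v u≢v) (≤-trans
                                                   (sum-inject₁≤sum (y u) (nonneg Y u _))
                                                   (≤-reflexive (mass Y u))) ⟩
          x u v * 1#                          ≈⟨ *-identityʳ (x u v) ⟩
          x u v                               ∎
        arc u (no _) = ≤-reflexive (sum-zero {ℕ.suc h} λ _ → refl)

      -- Layer 0 of the root already holds all its mass, and `l root (suc i)` being 1 truncates
      -- whatever flows in to 0. At any other node layer 0 is empty and the total inflow is at most
      -- 1.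
      rest-nonneg : ∀ v → 0# ≤ rest y v
      rest-nonneg v = x≤y⇒0≤y-x (bound (v ≟ root))
        where
        bound : Dec (v ≡ root) → y v zero + sum (moved y v) ≤ 1#
        bound (yes ≡.refl) = begin
          y root zero + sum (moved y root) ≤⟨ +-mono-≤ (≤-reflexive (root₀ Y)) (sum-mono {f = moved y root} stays) ⟩
          1# + sum {ℕ.suc h} (λ _ → 0#)    ≈⟨ +-congˡ (sum-zero {ℕ.suc h} λ _ → refl) ⟩
          1# + 0#                          ≈⟨ +-identityʳ 1# ⟩
          1#                               ∎
          where
          stays : ∀ i → moved y root i ≤ 0#
          stays i = +-cancelʳ-≤ 1# (begin
            moved y root i + 1#             ≈⟨ +-congˡ (l-root i) ⟨
            moved y root i + l root (suc i) ≤⟨ moved-cap root i ⟩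
            1#                              ≈⟨ +-identityˡ 1# ⟨
            0# + 1#                         ∎)
        bound (no v≢r) = begin
          y v zero + sum (moved y v) ≤⟨ +-mono-≤ (≤-reflexive (other₀ Y v v≢r)) (sum-mono {f = moved y v} λ i → x⊓y≤x _ _) ⟩
          0# + sum (inflow y v)      ≈⟨ +-identityˡ _ ⟩
          sum (inflow y v)           ≤⟨ sum-inflow≤1 v ⟩
          1#                         ∎

      push-mass : ∀ v → sum (push y v) ≈ 1#
      push-mass v = trans
        (solve 4 (λ a b r c → a :+ ((b :+ r) :+ c) := r :+ (a :+ (b :+ c))) refl
          (y v zero) (moved y v zero) (rest y v) (sum (moved y v ∘ suc)))
        (x-z+z≈x 1# _)

      layer₀≈l-first : ∀ v → y v zero ≈ l v (suc zero)
      layer₀≈l-first v with v ≟ root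
      ... | yes ≡.refl = trans (root₀ Y) (sym (l-root zero))
      ... | no v≢r     = trans (other₀ Y v v≢r) (sym (l-first v v≢r))

      push-nonneg : ∀ v i → 0# ≤ push y v i
      push-nonneg v zero          = nonneg Y v zero
      push-nonneg v (suc zero)    = +-nonneg (moved-nonneg v zero) (rest-nonneg v)
      push-nonneg v (suc (suc i)) = moved-nonneg v (suc i)

      -- Truncation gives the bound wherever nothing is returned. Layer 1 also receives `rest`, but
      -- there `l v (suc zero)` equals the mass in layer 0, so the bound says that layers 0 and 1
      -- together hold at most the total mass. This is why the missing mass is returned to layer 1.
      push-cap : ∀ v i → push y v i + l v i ≤ 1#
      push-cap v zero       = cap₁ Y v zero
      push-cap v (suc zero) = begin
        push y v (suc zero) + l v (suc zero) ≈⟨ +-congˡ (layer₀≈l-first v) ⟨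
        push y v (suc zero) + y v zero       ≤⟨ x≤x+y (sum-nonneg (push-nonneg v ∘ suc ∘ suc)) ⟩
        push y v (suc zero) + y v zero + sum (moved y v ∘ suc)
          ≈⟨ solve 3 (λ a b c → b :+ a :+ c := a :+ (b :+ c)) refl _ _ _ ⟩
        sum (push y v)                       ≈⟨ push-mass v ⟩
        1#                                   ∎
      push-cap v (suc (suc i)) = moved-cap v (suc i)

      push-assignment : Assignment 1# (push y)
      push-assignment = record
        { root₀  = root₀ Y
        ; other₀ = other₀ Y
        ; nonneg = push-nonneg
        ; cap    = λ v i → ≤-trans (+-monoʳ-≤ _ (≤-reflexive (*-identityˡ (l v i)))) (push-cap v i)
        ; mass   = push-mass
        }

      moved≤push : ∀ v i → moved y v i ≤ push y v (suc i)
      moved≤push v zero    = x≤x+y (rest-nonneg v)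
      moved≤push v (suc i) = ≤-refl

      -- As `moved` is a minimum, `a + b - 1#` has to lie below both of its arguments. The inflow is
      -- large enough because the arc `uv` alone carries `b * a`; the truncation bound is large
      -- enough by the ordering constraint on `l`.
      push-step : ∀ u v i → u ≢ v → y u (inject₁ i) + x u v ≤ 1# + push y v (suc i)
      push-step u v i u≢v = begin
        a + b                     ≤⟨ x-1≤ (⊓-glb by-inflow by-cap) ⟩
        1# + moved y v i          ≤⟨ +-monoʳ-≤ 1# (moved≤push v i) ⟩
        1# + push y v (suc i)     ∎
        where
        a b : Carrier
        a = y u (inject₁ i)
        b = x u v

        x-1≤ : ∀ {p q} → p - 1# ≤ q → p ≤ 1# + q
        x-1≤ {p} {q} le = begin
          p            ≈⟨ x-z+z≈x p 1# ⟨
          p - 1# + 1#  ≤⟨ +-monoˡ-≤ 1# le ⟩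
          q + 1#       ≈⟨ +-comm q 1# ⟩
          1# + q       ∎

        -- (1 - a) (1 - b) ≥ 0
        by-inflow : a + b - 1# ≤ inflow y v i
        by-inflow = ≤-trans (x≤y+z⇒x-z≤y (begin
          a + b                       ≈⟨ +-congʳ split ⟩
          (a * b + a * (1# - b)) + b  ≤⟨ +-monoˡ-≤ b (+-monoʳ-≤ (a * b)
                                           (*-shrink (≤1 Y u _) (x≤y⇒0≤y-x (x≤1 u v u≢v)))) ⟩
          (a * b + (1# - b)) + b      ≈⟨ +-assoc _ _ _ ⟩
          a * b + (1# - b + b)        ≈⟨ +-cong (*-comm a b) (x-z+z≈x 1# b) ⟩
          b * a + 1#                  ∎))
          (term≤sumOver (λ u → ¬? (u ≟ v)) (λ u u≢v → *-nonneg (x≥0 u v u≢v) (nonneg Y u _)) u u≢v)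
          where
          split : a ≈ a * b + a * (1# - b)
          split = sym (trans (sym (distribˡ a b (1# - b)))
            (trans (*-congˡ (trans (+-comm b _) (x-z+z≈x 1# b))) (*-identityʳ a)))

        by-cap : a + b - 1# ≤ 1# - l v (suc i)
        by-cap = x≤y+z⇒x-z≤y (begin
          a + b                    ≤⟨ x+z≤y⇒x≤y-z sum≤ ⟩
          1# + 1# - l v (suc i)    ≈⟨ +-assoc 1# 1# _ ⟩
          1# + (1# - l v (suc i))  ≈⟨ +-comm 1# _ ⟩
          1# - l v (suc i) + 1#    ∎)
          where
          sum≤ : a + b + l v (suc i) ≤ 1# + 1#
          -- Adding the cap of `u` in layer `i` to `l-step` puts `l u (inject₁ i)` on both sides,
          -- where it cancels.
          sum≤ = +-cancelʳ-≤ (l u (inject₁ i)) (begin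
            a + b + l v (suc i) + l u (inject₁ i)
              ≈⟨ solve 4 (λ a b l l′ → a :+ b :+ l :+ l′ := (a :+ l′) :+ (l :+ b)) refl _ _ _ _ ⟩
            (a + l u (inject₁ i)) + (l v (suc i) + b)
              ≤⟨ +-mono-≤ (cap₁ Y u _) (l-step u v i u≢v) ⟩
            1# + (1# + l u (inject₁ i))
              ≈⟨ +-assoc 1# 1# _ ⟨
            1# + 1# + l u (inject₁ i) ∎)

    -- Iterates, their partial sums and their averages.

    iterate : ℕ → V → Layer → Carrier
    iterate ℕ.zero    = initial
    iterate (ℕ.suc k) = push (iterate k)

    iterate-assignment : ∀ k → Assignment 1# (iterate k)
    iterate-assignment ℕ.zero    = initial-assignment
    iterate-assignment (ℕ.suc k) = push-assignment (iterate-assignment k)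

    partialSum : ℕ → V → Layer → Carrier
    partialSum ℕ.zero    v i = 0#
    partialSum (ℕ.suc k) v i = partialSum k v i + iterate k v i

    partialSum-assignment : ∀ k → Assignment (ι k) (partialSum k)
    partialSum-assignment ℕ.zero = record
      { root₀  = refl
      ; other₀ = λ _ _ → refl
      ; nonneg = λ _ _ → ≤-refl
      ; cap    = λ v i → ≤-reflexive (trans (+-identityˡ _) (zeroˡ _))
      ; mass   = λ _ → sum-zero {ℕ.suc (ℕ.suc h)} λ _ → refl
      }
    partialSum-assignment (ℕ.suc k) = add (partialSum-assignment k) (iterate-assignment k)

    -- Sum `push-step` over the first `k` iterates: iterate `j` at `u` is paired with iterate
    -- `j + 1` at `v`, hence the extra term on the right.
    partialSum-shift : ∀ k u v i → u ≢ v →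
      partialSum k u (inject₁ i) + ι k * x u v ≤ ι k + partialSum (ℕ.suc k) v (suc i)
    partialSum-shift ℕ.zero u v i u≢v = begin
      0# + 0# * x u v
        ≈⟨ trans (+-identityˡ _) (zeroˡ _) ⟩
      0#
        -- The initial iterate at `v` has no partner at `u`; its nonnegativity starts the induction.
        ≤⟨ +-nonneg ≤-refl (nonneg (partialSum-assignment 1) v (suc i)) ⟩
      0# + partialSum 1 v (suc i) ∎
    partialSum-shift (ℕ.suc k) u v i u≢v = begin
      (S + a) + (ι k + 1#) * b
        ≈⟨ solve 4 (λ S a k b → (S :+ a) :+ (k :+ con 1) :* b := (S :+ k :* b) :+ (a :+ b)) refl S a (ι k) b ⟩
      (S + ι k * b) + (a + b)
        ≤⟨ +-mono-≤ (partialSum-shift k u v i u≢v) (push-step (iterate-assignment k) u v i u≢v) ⟩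
      (ι k + S′) + (1# + a′)
        ≈⟨ solve 4 (λ k S′ o a′ → (k :+ S′) :+ (o :+ a′) := (k :+ o) :+ (S′ :+ a′)) refl (ι k) S′ 1# a′ ⟩
      (ι k + 1#) + (S′ + a′) ∎
      where
      S S′ a a′ b : Carrier
      S  = partialSum k u (inject₁ i)
      S′ = partialSum (ℕ.suc k) v (suc i)
      a  = iterate k u (inject₁ i)
      a′ = iterate (ℕ.suc k) v (suc i)
      b  = x u v

    -- To have the same partial sum on both sides, the last iterate at `u` is added and bounded by
    -- 1. This raises the constant to `ι (ℕ.suc k)` while `x` keeps the factor `ι k`; the mismatch
    -- is the source of the factor `k / (k + 1)`.
    partialSum-step : ∀ k u v i → u ≢ v →
      partialSum (ℕ.suc k) u (inject₁ i) + ι k * x u v ≤ ι (ℕ.suc k) + partialSum (ℕ.suc k) v (suc i)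
    partialSum-step k u v i u≢v = begin
      (S + a) + ι k * x u v   ≈⟨ solve 3 (λ S a b → (S :+ a) :+ b := (S :+ b) :+ a) refl S a _ ⟩
      (S + ι k * x u v) + a   ≤⟨ +-mono-≤ (partialSum-shift k u v i u≢v) (≤1 (iterate-assignment k) u _) ⟩
      (ι k + S′) + 1#         ≈⟨ solve 3 (λ k S′ o → (k :+ S′) :+ o := (k :+ o) :+ S′) refl (ι k) S′ 1# ⟩
      (ι k + 1#) + S′         ∎
      where
      S S′ a : Carrier
      S  = partialSum k u (inject₁ i)
      S′ = partialSum (ℕ.suc k) v (suc i)
      a  = iterate k u (inject₁ i)

    module _ (k : ℕ) {w} (0≤w : 0# ≤ w) (w-inverse : w * ι (ℕ.suc k) ≈ 1#) where
      average : V → Layer → Carrier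
      average v i = w * partialSum (ℕ.suc k) v i

      average-assignment : Assignment 1# average
      average-assignment = record
        { root₀  = trans (root₀ Y) w-inverse
        ; other₀ = other₀ Y
        ; nonneg = nonneg Y
        ; cap    = λ v i → begin
            average v i + 1# * l v i                ≈⟨ +-congˡ (*-congʳ w-inverse) ⟨
            average v i + (w * ι (ℕ.suc k)) * l v i ≤⟨ cap Y v i ⟩
            w * ι (ℕ.suc k)                         ≈⟨ w-inverse ⟩
            1#                                      ∎
        ; mass   = λ v → trans (mass Y v) w-inverse
        }
        where
        Y : Assignment (w * ι (ℕ.suc k)) average
        Y = scale 0≤w (partialSum-assignment (ℕ.suc k))

      average-step : ∀ u v i → u ≢ v →
                     average u (inject₁ i) + (w * ι k) * x u v ≤ 1# + average v (suc i)
      average-step u v i u≢v = begin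
        w * S + (w * ι k) * x u v   ≈⟨ +-congˡ (*-assoc w (ι k) (x u v)) ⟩
        w * S + w * (ι k * x u v)   ≈⟨ distribˡ w S _ ⟨
        w * (S + ι k * x u v)       ≤⟨ *-monoʳ-≤ 0≤w (partialSum-step k u v i u≢v) ⟩
        w * (ι (ℕ.suc k) + S′)      ≈⟨ distribˡ w _ S′ ⟩
        w * ι (ℕ.suc k) + w * S′    ≈⟨ +-congʳ w-inverse ⟩
        1# + w * S′                 ∎
        where
        S S′ : Carrier
        S  = partialSum (ℕ.suc k) u (inject₁ i)
        S′ = partialSum (ℕ.suc k) v (suc i)

-- The two relaxations and the inequality between their values.

module Relaxations {c ℓ₁ ℓ₂} (ℝ : Reals c ℓ₁ ℓ₂) where
  open Reals ℝ
  open OrderedField ℝ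
  open STPRBH ℝ
  open PosetReasoning poset

  objective≤ν : ∀ (M : MaxILP) z → MaxILP.Polyhedron M z → MaxILP.objective M z ≤ ν M
  objective≤ν M z z∈M = proj₁ (proj₂ (ν-exists M)) _ (z , z∈M , refl)

  ν≤ : ∀ (M : MaxILP) b → (∀ z → MaxILP.Polyhedron M z → MaxILP.objective M z ≤ b) → ν M ≤ b
  ν≤ M b bound = proj₂ (proj₂ (ν-exists M)) b λ { a (z , z∈M , eq) →
    ≤-trans (≤-reflexive (sym eq)) (bound z z∈M) }

  -- Off the root, layer 0 lies below layer 1, where `l-first` applies. Matching on `H` and `1≤H`
  -- lets `first I` reduce to `suc zero`.
  l-zero≈0 : ∀ I {z} → P-Polyhedron I z → ∀ v → P-Point.l z v zero ≈ 0#
  l-zero≈0 I@record { H = ℕ.suc h ; 1≤H = s≤s z≤n } z∈P v with v ≟ Instance.root I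
  ... | yes ≡.refl = P-Polyhedron.l-root z∈P
  ... | no v≢r     = antisym
    (≤-trans (P-Polyhedron.l-mono z∈P v zero) (≤-reflexive (P-Polyhedron.l-first z∈P v v≢r)))
    (proj₁ (P-Polyhedron.l-range z∈P v zero))

  -- In layer 0 both terms that bound the arc vanish. This settles the last-layer constraint for
  -- arcs into the root and also separates the two models on the triangle.
  arc-into-root≤0 : ∀ I {z} → P-Polyhedron I z → ∀ u → u ≢ Instance.root I →
                    P-Point.x z u (Instance.root I) ≤ 0#
  arc-into-root≤0 I {z} z∈P u u≢r = begin
    x u root              ≤⟨ P-Polyhedron.l+g≥x z∈P u root zero u≢r ⟩
    l u zero + g zero root ≈⟨ +-cong (l-zero≈0 I z∈P u) (P-Polyhedron.g-root z∈P) ⟩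
    0# + 0#               ≈⟨ +-identityˡ 0# ⟩
    0#                    ∎
    where
    open P-Point z
    open Instance I using (root)

  module _ (I : Instance) where
    open Instance I

    edgeSum-mono : ∀ {f g} → (∀ u v → u ≢ v → f u v ≤ g u v) → edgeSum I f ≤ edgeSum I g
    edgeSum-mono f≤g = sum-mono λ u → sumOver-mono (u <?_) λ v u<v → f≤g u v (<⇒≢ u<v)

    edgeSum-zero : ∀ {f} → (∀ u v → f u v ≈ 0#) → edgeSum I f ≈ 0#
    edgeSum-zero {f} f≈0 = sum-zero λ u → sumOver-zero (λ v → u <? v) {f u} (f≈0 u)

    *-distribˡ-edgeSum : ∀ z f → z * edgeSum I f ≈ edgeSum I (λ u v → z * f u v)
    *-distribˡ-edgeSum z f = trans
      (*-distribˡ-sum z (λ u → sumOver (λ v → u <? v) (f u)))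
      (sum-cong-≋ λ u → *-distribˡ-sumOver (λ v → u <? v) z (f u))

    edgeRevenue : (Fin n → Fin n → Carrier) → Carrier
    edgeRevenue x = edgeSum I λ u v → x u v * revenue v + x v u * revenue u

    edgeRevenue-scale : ∀ m x → m * edgeRevenue x ≤ edgeRevenue (λ u v → m * x u v)
    edgeRevenue-scale m x = begin
      m * edgeRevenue x
        ≈⟨ *-distribˡ-edgeSum m _ ⟩
      edgeSum I (λ u v → m * (x u v * revenue v + x v u * revenue u))
        ≤⟨ edgeSum-mono (λ u v _ → ≤-reflexive
             (solve 5 (λ m a p b q → m :* (a :* p :+ b :* q) := (m :* a) :* p :+ (m :* b) :* q)
                refl m (x u v) (revenue v) (x v u) (revenue u))) ⟩
      edgeRevenue (λ u v → m * x u v) ∎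

    -- X2 is homogeneous in `x`; X1, X3 and X5 survive because weights only shrink, in X5 against
    -- positive costs.
    common-scale : ∀ {m x} → 0# ≤ m → m ≤ 1# → CommonConstraints I x →
                   CommonConstraints I (λ u v → m * x u v)
    common-scale {m} {x} 0≤m m≤1 cc = record
      { X1 = λ v → ≤-trans (sumOver-mono (λ u → ¬? (u ≟ v)) λ u u≢v → shrink u v u≢v) (X1 v)
      ; X2 = λ v w v≢r w≢v → let P? = λ u → ¬? (u ≟ v) ×-dec ¬? (u ≟ w) in begin
          m * x v w                            ≤⟨ *-monoʳ-≤ 0≤m (X2 v w v≢r w≢v) ⟩
          m * sumOver P? (λ u → x u v)         ≈⟨ *-distribˡ-sumOver P? m (λ u → x u v) ⟩
          sumOver P? (λ u → m * x u v)         ∎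
      ; X3 = λ u v u≢v → *-nonneg 0≤m (proj₁ (X3 u v u≢v))
                       , ≤-trans (shrink u v u≢v) (proj₂ (X3 u v u≢v))
      ; X5 = ≤-trans (edgeSum-mono λ u v u≢v → *-monoʳ-≤ (proj₁ (cost-pos u v u≢v))
               (+-mono-≤ (shrink u v u≢v) (shrink v u (≢-sym u≢v)))) X5
      }
      where
      open CommonConstraints cc
      shrink : ∀ u v → u ≢ v → m * x u v ≤ x u v
      shrink u v u≢v = *-shrink m≤1 (proj₁ (X3 u v u≢v))

  a+b≤1+c⇒a-c+b≤1 : ∀ {a b c} → a + b ≤ 1# + c → a - c + b ≤ 1#
  a+b≤1+c⇒a-c+b≤1 {a} {b} {c} le = +-cancelʳ-≤ c (begin
    a - c + b + c   ≈⟨ solve 4 (λ a c′ b c → a :+ c′ :+ b :+ c := a :+ c′ :+ c :+ b) refl a (- c) b c ⟩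
    a - c + c + b   ≈⟨ +-congʳ (x-z+z≈x a c) ⟩
    a + b           ≤⟨ le ⟩
    1# + c          ∎)

  -- With `w` the reciprocal of `k + 1`, the `y` is the average of the first `k + 1` iterates. Those
  -- iterates depend on the unscaled `x`; only the final point uses `k / (k + 1)` times it.
  averaged-point : ∀ I {z} → P-Polyhedron I z → ∀ k {w} → 0# ≤ w → w * ι (ℕ.suc k) ≈ 1# →
    ∃ λ y → A-Polyhedron I (record { x = λ u v → (w * ι k) * P-Point.x z u v ; y = y })
  averaged-point I@record { H = ℕ.suc h ; 1≤H = s≤s z≤n } {z} z∈P k {w} 0≤w w-inverse = y , record
    { common  = common-scale I 0≤m m≤1 common
    ; y-root₀ = root₀
    -- Since `l root (suc i)` is 1, the cap leaves the root no mass outside layer 0.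
    ; y-root₊ = λ i → antisym
        (+-cancelʳ-≤ 1# (begin
          y root (suc i) + 1#             ≈⟨ +-congˡ (l-root-suc i) ⟨
          y root (suc i) + l root (suc i) ≤⟨ cap₁ Y root (suc i) ⟩
          1#                              ≈⟨ +-identityˡ 1# ⟨
          0# + 1#                         ∎))
        (nonneg root (suc i))
    ; y-zero  = other₀
    ; y-sum   = λ v v≢r → trans (sym (+-identityˡ _))
                            (trans (+-congʳ (sym (other₀ v v≢r))) (mass v))
    ; y-step  = λ u v i u≢v → a+b≤1+c⇒a-c+b≤1 (average-step k 0≤w w-inverse u v i u≢v)
    ; y-last  = λ u v u≢v → y-last u v u≢v (v ≟ root)
    ; y-range = λ v i → nonneg v i , ≤1 Y v i
    }
    where
    open Instance I using (n; root)
    open P-Point z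
    open P-Polyhedron z∈P
    open CommonConstraints common

    l-root-suc : ∀ i → l root (suc i) ≈ 1#
    l-root-suc i = antisym (proj₂ (l-range root (suc i))) (begin
      1#                            ≈⟨ g+l root zero ⟨
      g zero root + l root (suc zero) ≈⟨ +-congʳ g-root ⟩
      0# + l root (suc zero)        ≈⟨ +-identityˡ _ ⟩
      l root (suc zero)             ≤⟨ stepwise-mono (l root ∘ suc) (λ j → l-mono root (suc j)) i ⟩
      l root (suc i)                ∎)

    -- Eliminates `g`: the arc constraint in layer `i` with `g (inject₁ i) v` replaced by
    -- `1# - l v (suc i)`.
    l-step : ∀ u v i → u ≢ v → l v (suc i) + x u v ≤ 1# + l u (inject₁ i)
    l-step u v i u≢v = begin
      l v (suc i) + x u v                              ≤⟨ +-monoʳ-≤ _ (l+g≥x u v (inject₁ i) u≢v) ⟩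
      l v (suc i) + (l u (inject₁ i) + g (inject₁ i) v)
        ≈⟨ solve 3 (λ a b c → a :+ (b :+ c) := (c :+ a) :+ b) refl _ _ _ ⟩
      (g (inject₁ i) v + l v (suc i)) + l u (inject₁ i) ≈⟨ +-congʳ (g+l v i) ⟩
      1# + l u (inject₁ i)                             ∎

    open Averaging ℝ
    open FromOrdering n h root x l
      (λ u v u≢v → proj₁ (X3 u v u≢v)) (λ u v u≢v → proj₂ (X3 u v u≢v)) X1
      (λ v i → proj₁ (l-range v i)) (λ v i → proj₂ (l-range v i))
      (l-zero≈0 I z∈P) l-first l-root-suc l-step

    y : Fin n → Fin (ℕ.suc (ℕ.suc h)) → Carrier
    y = average k 0≤w w-inverse

    Y : Assignment 1# y
    Y = average-assignment k 0≤w w-inverse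

    open Assignment Y

    0≤m : 0# ≤ w * ι k
    0≤m = *-nonneg 0≤w (ι-nonneg k)

    m≤1 : w * ι k ≤ 1#
    m≤1 = ≤-trans (*-monoʳ-≤ 0≤w (x≤x+y 0≤1)) (≤-reflexive w-inverse)

    -- No push leaves the last layer, so this constraint comes from the ordering directly. Off the
    -- root `g` vanishes in the last layer, so `x u v` is at most `l u (last I)` and the cap
    -- applies; arcs into the root have no weight.
    y-last : ∀ u v → u ≢ v → Dec (v ≡ root) → y u (last I) + (w * ι k) * x u v ≤ 1#
    y-last u v u≢v v≟r = ≤-trans
      (+-monoʳ-≤ _ (*-shrink m≤1 (proj₁ (X3 u v u≢v)))) (unscaled v≟r)
      where
      unscaled : Dec (v ≡ root) → y u (last I) + x u v ≤ 1#
      unscaled (yes ≡.refl) = begin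
        y u (last I) + x u root ≤⟨ +-mono-≤ (≤1 Y u (last I)) (arc-into-root≤0 I z∈P u u≢v) ⟩
        1# + 0#                 ≈⟨ +-identityʳ 1# ⟩
        1#                      ∎
      unscaled (no v≢r) = begin
        y u (last I) + x u v          ≤⟨ +-monoʳ-≤ _ (l+g≥x u v (last I) u≢v) ⟩
        y u (last I) + (l u (last I) + g (last I) v)
          ≈⟨ +-congˡ (trans (+-congˡ (g-last v v≢r)) (+-identityʳ _)) ⟩
        y u (last I) + l u (last I)   ≤⟨ cap₁ Y u (last I) ⟩
        1#                            ∎

  -- Let `E` be the edge revenue of a P-feasible point and `D` the A-value less the root revenue.
  -- The averaged points give `k / (k + 1) * E ≤ D` for every `k`. Clearing denominators replaces
  -- the limit by the Archimedean property.
  P-stronger : P-STPRBH StrongerThan A-STPRBH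
  P-stronger I = ν≤ (P-STPRBH I) N bound
    where
    open Instance I
    N : Carrier
    N = ν (A-STPRBH I)

    bound : ∀ z → P-Polyhedron I z → revenueCollected I (P-Point.x z) ≤ N
    bound z z∈P = begin
      revenue root + E   ≈⟨ +-comm _ E ⟩
      E + revenue root   ≤⟨ x≤y-z⇒x+z≤y E≤D ⟩
      N                  ∎
      where
      open P-Point z
      E D : Carrier
      E = edgeRevenue I x
      D = N - revenue root

      scaled : ∀ k → ι k * E ≤ ι (ℕ.suc k) * D
      scaled k = begin
        ι k * E                         ≈⟨ *-identityˡ _ ⟨
        1# * (ι k * E)                  ≈⟨ *-congʳ s*w≈1 ⟨
        (s * w) * (ι k * E)             ≈⟨ solve 4 (λ s w k E → (s :* w) :* (k :* E) := s :* ((w :* k) :* E)) refl s w (ι k) E ⟩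
        s * ((w * ι k) * E)             ≤⟨ *-monoʳ-≤ (ι-nonneg (ℕ.suc k)) (x+z≤y⇒x≤y-z fits) ⟩
        s * D                           ∎
        where
        s w : Carrier
        s = ι (ℕ.suc k)
        w = proj₁ (inverse s (ι-suc≉0 k))

        s*w≈1 : s * w ≈ 1#
        s*w≈1 = proj₂ (inverse s (ι-suc≉0 k))

        point : ∃ λ y → A-Polyhedron I (record { x = λ u v → (w * ι k) * x u v ; y = y })
        point = averaged-point I z∈P k (reciprocal-nonneg (ι-nonneg (ℕ.suc k)) s*w≈1)
                  (trans (*-comm w s) s*w≈1)

        fits : (w * ι k) * E + revenue root ≤ N
        fits = begin
          (w * ι k) * E + revenue root          ≈⟨ +-comm _ (revenue root) ⟩
          revenue root + (w * ι k) * E          ≤⟨ +-monoʳ-≤ _ (edgeRevenue-scale I (w * ι k) x) ⟩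
          revenueCollected I (λ u v → (w * ι k) * x u v)
            ≤⟨ objective≤ν (A-STPRBH I) _ (proj₂ point) ⟩
          N                                     ∎

      E≤D : E ≤ D
      E≤D = begin
        E             ≈⟨ x-z+z≈x E D ⟨
        -- Moving `ι k * D` across turns `scaled` into `ι k * (E - D) ≤ D` for all `k`, so the
        -- multiples of `E - D` are bounded.
        E - D + D     ≤⟨ +-monoˡ-≤ D (multiples-bounded⇒nonpos {E - D} {D} λ k → +-cancelʳ-≤ (ι k * D) (begin
          ι k * (E - D) + ι k * D ≈⟨ distribˡ (ι k) (E - D) D ⟨
          ι k * (E - D + D)       ≈⟨ *-congˡ (x-z+z≈x E D) ⟩
          ι k * E                 ≤⟨ scaled k ⟩
          (ι k + 1#) * D          ≈⟨ solve 2 (λ k D → (k :+ con 1) :* D := D :+ k :* D) refl (ι k) D ⟩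
          D + ι k * D             ∎)) ⟩
        0# + D        ≈⟨ +-identityˡ D ⟩
        D             ∎

  -- Strictness on a triangle with half-integral weights.

  2·1≉0 : ¬ (1# + 1# ≈ 0#)
  2·1≉0 eq = 0≉1 (antisym 0≤1 (≤-trans (x≤x+y 0≤1) (≤-reflexive eq)))

  half : Carrier
  half = proj₁ (inverse (1# + 1#) 2·1≉0)

  half+half≈1 : half + half ≈ 1#
  half+half≈1 = trans (solve 1 (λ p → p :+ p := con 2 :* p) refl half) (proj₂ (inverse (1# + 1#) 2·1≉0))

  0≤half : 0# ≤ half
  0≤half = reciprocal-nonneg (+-nonneg 0≤1 0≤1) (proj₂ (inverse (1# + 1#) 2·1≉0))

  half≤1 : half ≤ 1#
  half≤1 = ≤-trans (x≤x+y 0≤half) (≤-reflexive half+half≈1)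

  half≰0 : ¬ (half ≤ 0#)
  half≰0 half≤0 = 0≉1 (antisym 0≤1 (begin
    1#           ≈⟨ half+half≈1 ⟨
    half + half  ≤⟨ +-mono-≤ half≤0 half≤0 ⟩
    0# + 0#      ≈⟨ +-identityˡ 0# ⟩
    0#           ∎))

  rootRevenue : Fin 3 → Carrier
  rootRevenue 0F      = 1#
  rootRevenue (suc _) = 0#

  -- Only the root pays.  P forbids arcs into it, whereas A admits the directed
  -- triangle through the root with x = 1/2.
  triangle : Instance
  triangle = record
    { n         = 3
    ; root      = 0F
    ; cost      = λ _ _ → 1#
    ; cost-sym  = λ _ _ → refl
    ; cost-pos  = λ _ _ _ → 0≤1 , 0≉1
    ; revenue   = rootRevenue
    ; revenue≥0 = λ { 0F → 0≤1 ; (suc _) → ≤-refl }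
    ; H         = 2
    ; 1≤H       = s≤s z≤n
    ; B         = half + half + half
    ; B≥0       = +-nonneg (+-nonneg 0≤half 0≤half) 0≤half
    }

  -- Edge revenue could come only from arcs into the root, so P collects just the revenue 1 of the
  -- root itself.
  triangle-P≤1 : ν (P-STPRBH triangle) ≤ 1#
  triangle-P≤1 = ν≤ (P-STPRBH triangle) 1# bound
    where
    bound : ∀ z → P-Polyhedron triangle z → revenueCollected triangle (P-Point.x z) ≤ 1#
    bound z z∈P = begin
      1# + edgeRevenue triangle x              ≤⟨ +-monoʳ-≤ 1# (edgeSum-mono triangle λ u v u≢v →
                                                    +-mono-≤ (arc≤0 u v u≢v) (arc≤0 v u (≢-sym u≢v))) ⟩
      1# + edgeSum triangle (λ _ _ → 0# + 0#)  ≈⟨ +-congˡ (edgeSum-zero triangle λ _ _ → +-identityˡ 0#) ⟩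
      1# + 0#                                  ≈⟨ +-identityʳ 1# ⟩
      1#                                       ∎
      where
      open P-Point z
      arc≤0 : ∀ u v → u ≢ v → x u v * rootRevenue v ≤ 0#
      arc≤0 u 0F      u≢v = ≤-trans (≤-reflexive (*-identityʳ (x u 0F))) (arc-into-root≤0 triangle z∈P u u≢v)
      arc≤0 u (suc v) u≢v = ≤-reflexive (zeroʳ (x u (suc v)))

  cycle : Fin 3 → Fin 3 → Carrier
  cycle 0F 1F = half
  cycle 1F 2F = half
  cycle 2F 0F = half
  cycle _  _  = 0#

  -- Splitting each other node evenly over layers 1 and 2 keeps its `y` at most `half`. As arcs
  -- weigh at most `half` too, the constraints on arcs leaving these nodes hold regardless of the
  -- target layer, even for the arc back to the root.
  spread : Fin 3 → Fin 3 → Carrier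
  spread 0F      0F      = 1#
  spread 0F      (suc _) = 0#
  spread (suc _) 0F      = 0#
  spread (suc _) (suc _) = half

  cycle-range : ∀ u v → (0# ≤ cycle u v) × (cycle u v ≤ half)
  cycle-range 0F 0F = ≤-refl , 0≤half
  cycle-range 0F 1F = 0≤half , ≤-refl
  cycle-range 0F 2F = ≤-refl , 0≤half
  cycle-range 1F 0F = ≤-refl , 0≤half
  cycle-range 1F 1F = ≤-refl , 0≤half
  cycle-range 1F 2F = 0≤half , ≤-refl
  cycle-range 2F 0F = 0≤half , ≤-refl
  cycle-range 2F 1F = ≤-refl , 0≤half
  cycle-range 2F 2F = ≤-refl , 0≤half

  spread-nonneg : ∀ v i → 0# ≤ spread v i
  spread-nonneg 0F      0F      = 0≤1
  spread-nonneg 0F      (suc _) = ≤-refl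
  spread-nonneg (suc _) 0F      = ≤-refl
  spread-nonneg (suc _) (suc _) = 0≤half

  spread-other≤half : ∀ v i → spread (suc v) i ≤ half
  spread-other≤half v 0F      = 0≤half
  spread-other≤half v (suc _) = ≤-refl

  cycle-common : CommonConstraints triangle cycle
  cycle-common = record
    { X1 = λ
      { 0F → ≤-trans (≤-reflexive (solve 1 (λ p → con 0 :+ (con 0 :+ (p :+ con 0)) := p) refl half)) half≤1
      ; 1F → ≤-trans (≤-reflexive (solve 1 (λ p → p :+ (con 0 :+ (con 0 :+ con 0)) := p) refl half)) half≤1
      ; 2F → ≤-trans (≤-reflexive (solve 1 (λ p → con 0 :+ (p :+ (con 0 :+ con 0)) := p) refl half)) half≤1
      }
    -- Nodes 1 and 2 each pass on exactly what they receive. Where `w` is the predecessor on the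
    -- cycle, its exclusion leaves sum 0, matching the weight 0 of the reverse arc.
    ; X2 = λ
      { 0F _  v≢r _   → ⊥-elim (v≢r ≡.refl)
      ; 1F 0F _   _   → ≤-reflexive (solve 0 (con 0 := con 0 :+ (con 0 :+ (con 0 :+ con 0))) refl)
      ; 1F 1F _   w≢v → ⊥-elim (w≢v ≡.refl)
      ; 1F 2F _   _   → ≤-reflexive (solve 1 (λ p → p := p :+ (con 0 :+ (con 0 :+ con 0))) refl half)
      ; 2F 0F _   _   → ≤-reflexive (solve 1 (λ p → p := con 0 :+ (p :+ (con 0 :+ con 0))) refl half)
      ; 2F 1F _   _   → ≤-reflexive (solve 0 (con 0 := con 0 :+ (con 0 :+ (con 0 :+ con 0))) refl)
      ; 2F 2F _   w≢v → ⊥-elim (w≢v ≡.refl)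
      }
    ; X3 = λ u v _ → proj₁ (cycle-range u v) , ≤-trans (proj₂ (cycle-range u v)) half≤1
    -- Three arcs of weight `half` at unit cost exhaust the budget exactly.
    ; X5 = ≤-reflexive (solve 1 (λ p →
        (con 0 :+ (con 1 :* (p :+ con 0) :+ (con 1 :* (con 0 :+ p) :+ con 0)))
          :+ ((con 0 :+ (con 0 :+ (con 1 :* (p :+ con 0) :+ con 0)))
          :+ ((con 0 :+ (con 0 :+ (con 0 :+ con 0))) :+ con 0))
        := p :+ p :+ p) refl half)
    }

  cycle∈A : A-Polyhedron triangle (record { x = cycle ; y = spread })
  cycle∈A = record
    { common  = cycle-common
    ; y-root₀ = refl
    ; y-root₊ = λ _ → refl
    ; y-zero  = λ { 0F v≢r → ⊥-elim (v≢r ≡.refl) ; (suc _) _ → refl }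
    ; y-sum   = λ { 0F v≢r → ⊥-elim (v≢r ≡.refl)
                  ; (suc _) _ → trans (+-congˡ (+-identityʳ half)) half+half≈1 }
    ; y-step  = λ u v i u≢v → a+b≤1+c⇒a-c+b≤1 (step u v i u≢v)
    ; y-last  = λ u v _ → small (last≤half u) (proj₂ (cycle-range u v))
    ; y-range = λ v i → spread-nonneg v i , spread≤1 v i
    }
    where
    spread≤1 : ∀ v i → spread v i ≤ 1#
    spread≤1 0F      0F      = ≤-refl
    spread≤1 0F      (suc _) = 0≤1
    spread≤1 (suc v) i       = ≤-trans (spread-other≤half v i) half≤1

    small : ∀ {p q} → p ≤ half → q ≤ half → p + q ≤ 1#
    small p≤ q≤ = ≤-trans (+-mono-≤ p≤ q≤) (≤-reflexive half+half≈1)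

    last≤half : ∀ u → spread u 2F ≤ half
    last≤half 0F      = 0≤half
    last≤half (suc _) = ≤-refl

    step : ∀ u v (i : Fin 2) → u ≢ v → spread u (inject₁ i) + cycle u v ≤ 1# + spread v (suc i)
    step 0F      0F      0F u≢v = ⊥-elim (u≢v ≡.refl)
    -- The one place where `spread u` exceeds `half`: the root in layer 0. Layer 1 of the target
    -- holds `half`, enough to cover the arc.
    step 0F      (suc v) 0F _   = +-monoʳ-≤ 1# (proj₂ (cycle-range 0F (suc v)))
    step 0F      v       1F _   = ≤-trans (small 0≤half (proj₂ (cycle-range 0F v))) (x≤x+y (spread-nonneg v 2F))
    step (suc u) v       i  _   = ≤-trans
      (small (spread-other≤half u (inject₁ i)) (proj₂ (cycle-range (suc u) v)))
      (x≤x+y (spread-nonneg v (suc i)))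

  cycle-value : revenueCollected triangle cycle ≈ 1# + half
  cycle-value = solve 1 (λ p →
    -- The unfolded edge sum, with zeros for the pairs that are not ordered. The only paying term is
    -- `p :* con 1`, from the arc from node 2 to the root.
    con 1 :+ ((con 0 :+ ((p :* con 0 :+ con 0 :* con 1) :+ ((con 0 :* con 0 :+ p :* con 1) :+ con 0)))
          :+ ((con 0 :+ (con 0 :+ ((p :* con 0 :+ con 0 :* con 0) :+ con 0)))
          :+ ((con 0 :+ (con 0 :+ (con 0 :+ con 0))) :+ con 0)))
    := con 1 :+ p) refl half

  -- Equal values would force `1# + half ≤ 1#`, since the half cycle attains the left side in A and
  -- the right side bounds P.
  triangle-strict : ν (P-STPRBH triangle) < ν (A-STPRBH triangle)
  triangle-strict = P-stronger triangle , λ P≈A → half≰0 (+-cancelʳ-≤ 1# (begin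
    half + 1#                       ≈⟨ +-comm half 1# ⟩
    1# + half                       ≈⟨ cycle-value ⟨
    revenueCollected triangle cycle ≤⟨ objective≤ν (A-STPRBH triangle) _ cycle∈A ⟩
    ν (A-STPRBH triangle)           ≈⟨ P≈A ⟨
    ν (P-STPRBH triangle)           ≤⟨ triangle-P≤1 ⟩
    1#                              ≈⟨ +-identityˡ 1# ⟨
    0# + 1#                         ∎))

theorem5 : ∀ {c ℓ₁ ℓ₂} (ℝ : Reals c ℓ₁ ℓ₂) → let open STPRBH ℝ in P-STPRBH StrictlyStrongerThan A-STPRBH
theorem5 ℝ = P-stronger , triangle , triangle-strict
  where open Relaxations ℝ
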